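{- For every parallel pushdown automaton $M$ there is a finite weakly guarded recursive specification $\Gamma$ (with a designated initial identifier) over $\mathrm{BCP}^{\mathbf{0}\mathbf{1}}$ extended with infinite choice (countable sums, with a countable set of communicated values) such that the process graph of $\Gamma$ and the process graph $\mathcal{P}(M)$ of $M$ are divergence-preserving branching bisimilar.
   Context: **Labelled transition systems and process graphs.** A labelled transition system is a tuple $(\mathcal{S},\mathcal{A},\rightarrow,\downarrow)$ with $\mathcal{S}$ a set of states, $\mathcal{A}$ a set of actions, $\tau\notin\mathcal{A}$ the silent action, $\rightarrow\,\subseteq\mathcal{S}\times(\mathcal{A}\cup\{\tau\})\times\mathcal{S}$ the transition relation, and $\downarrow\,\subseteq\mathcal{S}$ the set of accepting (final) states; write $s\xrightarrow{a}s'$ and $s\downarrow$. A process graph is a labelled transition system with a designated root state. Write $s\Rightarrow t$ if $t$ can be reached from $s$ by zero or more $\tau$-transitions, $s\Rightarrow^{+}t$ if by one or more, and $s\xrightarrow{(a)}t$ if $s\xrightarrow{a}t$, or $a=\tau$ and $s=t$. **Divergence-preserving branching bisimilarity.** A symmetric relation $R$ on $\mathcal{S}$ is a branching bisimulation if for all $s\mathrel{R}t$ and $a\in\mathcal{A}\cup\{\tau\}$: (1) if $s\xrightarrow{a}s'$ then there are $t'',t'$ with $t\Rightarrow t''\xrightarrow{(a)}t'$, $s\mathrel{R}t''$ and $s'\mathrel{R}t'$; (2) if $s\downarrow$ then there is $t'$ with $t\Rightarrow t'$ and $t'\downarrow$. It is divergence-preserving if for all $s,t$, whenever there is an infinite sequence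 $s=s_0\xrightarrow{\tau}s_1\xrightarrow{\tau}s_2\cdots$ with $s_i\mathrel{R}t$ for all $i\geq 0$, there is $t'$ with $t\Rightarrow^{+}t'$ and $s_i\mathrel{R}t'$ for some $i\geq 0$. States $s,t$ are divergence-preserving branching bisimilar if some divergence-preserving branching bisimulation relates them. Two process graphs are divergence-preserving branching bisimilar if their roots are, in the disjoint union of the two underlying labelled transition systems (over the union of their action sets). **Parallel pushdown automata.** $\mathcal{D}^{\{\!\{\,\}\!\}}$ is the set of finite multisets (bags) over $\mathcal{D}$, $\cup$ on bags is multiset sum, and $\mathcal{D}^{\pm}=\{+d\mid d\in\mathcal{D}\}\cup\{ -d\mid d\in\mathcal{D}\}$ (two disjoint copies of $\mathcal{D}$). A parallel pushdown automaton is a tuple $M=(\mathcal{S},\mathcal{A},\mathcal{D},\rightarrow,\uparrow,\downarrow)$ with $\mathcal{S}$ a finite set of states, $\mathcal{A}$ a finite input alphabet ($\tau\notin\mathcal{A}$), $\mathcal{D}$ a finite data alphabet, $\rightarrow\,\subseteq\mathcal{S}\times(\mathcal{A}\cup\{\tau\})\times\mathcal{D}^{\pm}\times\mathcal{D}^{\{\!\{\,\}\!\}}\times\mathcal{S}$ a finite set of transitions, $\uparrow\,\in\mathcal{S}$ the initial state, and $\downarrow\,\subseteq\mathcal{S}$ the accepting states. Write $s\xrightarrow{a[+d/x]}t$ for $(s,a,+d,x,t)\in\,\rightarrow$, and $s\xrightarrow{a[-d/x]}t$ for $(s,a,-d,x,t)\in\,\rightarrow$. The process graph $\mathcal{P}(M)$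 has states $(s,x)$ with $s\in\mathcal{S}$, $x\in\mathcal{D}^{\{\!\{\,\}\!\}}$; root $(\uparrow,\emptyset)$; accepting states all $(s,x)$ with $s\in\,\downarrow$; and exactly the transitions $(s,\{\!\{d\}\!\}\cup x)\xrightarrow{a}(s',x'\cup x)$ whenever $s\xrightarrow{a[+d/x']}s'$, and $(s,x)\xrightarrow{a}(s',x'\cup x)$ whenever there is $d\notin x$ with $s\xrightarrow{a[-d/x']}s'$. **Process algebra $\mathrm{BCP}^{\mathbf{0}\mathbf{1}}$ with infinite choice.** Let $\mathcal{A}$ be a set of actions, $\tau\notin\mathcal{A}$ the silent action, and $\mathcal{P}$ a finite set of process identifiers. Let $\mathcal{C}$ be a finite set of communication ports and $\mathcal{V}$ a countable (possibly infinite) set of values; for $c\in\mathcal{C}$, $v\in\mathcal{V}$ the set $\mathcal{A}$ contains the send action $c!v$, the receive action $c?v$ and the communication action $c(v)$. For $C\subseteq\mathcal{C}$ let $\mathit{COM}_C=\{c!v,c?v\mid c\in C,v\in\mathcal{V}\}$. The sets $\mathcal{A}$, $\mathcal{C}$, $\mathcal{V}$ are parameters, and giving a specification includes choosing them. Process expressions are generated by $p::=\mathbf{0}\mid\mathbf{1}\mid a.p\mid p+p\mid\sum_{i\in I}p_i\mid p\parallel p\mid X\mid\partial_C(p)\mid\tau_C(p)$ with $a\in\mathcal{A}\cup\{\tau\}$, $I$ a countable index set, $X\in\mathcal{P}$, $C\subseteq\mathcal{C}$ (there is no priority operator). A finite recursive specification $\Gamma$ assigns to every $X$ in the finite set $\mathcal{P}$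 exactly one defining equation $X\stackrel{\mathrm{def}}{=}p$ with $p$ a process expression. It is weakly guarded if every occurrence of a process identifier in the right-hand side of a defining equation is within the scope of an action prefix $a.\_$ with $a\in\mathcal{A}\cup\{\tau\}$. Transitions and acceptance relative to $\Gamma$ are the least ones satisfying: $\mathbf{1}\downarrow$; $a.p\xrightarrow{a}p$; if $p\downarrow$ or $q\downarrow$ then $(p+q)\downarrow$; if $p\xrightarrow{a}p'$ then $p+q\xrightarrow{a}p'$ and $q+p\xrightarrow{a}p'$; if $p_j\downarrow$ for some $j\in I$ then $(\sum_{i\in I}p_i)\downarrow$; if $p_j\xrightarrow{a}p'$ for some $j\in I$ then $\sum_{i\in I}p_i\xrightarrow{a}p'$; if $p\downarrow$ and $q\downarrow$ then $(p\parallel q)\downarrow$; if $p\xrightarrow{a}p'$ then $p\parallel q\xrightarrow{a}p'\parallel q$ and $q\parallel p\xrightarrow{a}q\parallel p'$; if $p\xrightarrow{c!v}p'$ and $q\xrightarrow{c?v}q'$ then $p\parallel q\xrightarrow{c(v)}p'\parallel q'$ and $q\parallel p\xrightarrow{c(v)}q'\parallel p'$; if $X\stackrel{\mathrm{def}}{=}p$ and $p\xrightarrow{a}p'$ then $X\xrightarrow{a}p'$; if $X\stackrel{\mathrm{def}}{=}p$ and $p\downarrow$ then $X\downarrow$; if $p\downarrow$ then $\partial_C(p)\downarrow$ and $\tau_C(p)\downarrow$; if $p\xrightarrow{a}p'$ and $a\notin\mathit{COM}_C$ then $\partial_C(p)\xrightarrow{a}\partial_C(p')$; if $p\xrightarrow{c(v)}p'$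 with $c\in C$ then $\tau_C(p)\xrightarrow{\tau}\tau_C(p')$; if $p\xrightarrow{a}p'$ and $a$ is not of the form $c(v)$ with $c\in C$ then $\tau_C(p)\xrightarrow{a}\tau_C(p')$. The process graph of $\Gamma$ is this labelled transition system with the initial identifier as root. -}

module Defs where

open import Level using (Level; _⊔_; 0ℓ) renaming (suc to lsuc)
open import Data.Nat using (ℕ; suc; _+_)
open import Data.Fin using (Fin)
open import Data.Fin.Subset using (Subset) renaming (_∈_ to _∈ˢ_)
open import Data.Vec using (Vec; replicate; zipWith; lookup; _[_]≔_)
open import Data.List using (List)
open import Data.List.Membership.Propositional using (_∈_)
open import Data.Product using (Σ-syntax; ∃-syntax; _×_; _,_)
open import Data.Sum using (_⊎_; inj₁; inj₂)
open import Function.Bundles using (_↣_; Injection)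
open import Relation.Binary.Core using (Rel)
open import Relation.Binary.Definitions using (Symmetric)
open import Relation.Binary.Construct.Closure.ReflexiveTransitive using (Star)
open import Relation.Binary.Construct.Closure.Transitive using (TransClosure)
open import Relation.Binary.PropositionalEquality using (_≡_; refl; cong)
open import Relation.Nullary using (¬_)

private
  variable
    ℓ ℓ₁ ℓ₂ : Level

------------------------------------------------------------------------
-- Labelled transition systems

data Actτ (A : Set) : Set where
  τ   : Actτ A
  act : A → Actτ A

mapτ : {A B : Set} → (A → B) → Actτ A → Actτ B
mapτ f τ       = τ
mapτ f (act a) = act (f a)

record LTS (A : Set) (ℓ : Level) : Set (lsuc ℓ) where
  field
    State  : Set ℓ
    _—[_]→_ : State → Actτ A → State → Set ℓ
    _↓     : State → Set ℓ

  infix 4 _—[_]→_ _—τ→_ _⇒_ _⇒⁺_ _—[[_]]→_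

  _—τ→_ : Rel State ℓ
  s —τ→ t = s —[ τ ]→ t

  _⇒_ : Rel State ℓ
  _⇒_ = Star _—τ→_

  _⇒⁺_ : Rel State ℓ
  _⇒⁺_ = TransClosure _—τ→_

  -- The transition written s —(a)→ t on paper.
  _—[[_]]→_ : State → Actτ A → State → Set ℓ
  s —[[ a ]]→ t = (s —[ a ]→ t) ⊎ (a ≡ τ × s ≡ t)

record ProcessGraph (A : Set) (ℓ : Level) : Set (lsuc ℓ) where
  field
    lts  : LTS A ℓ
    root : LTS.State lts

------------------------------------------------------------------------
-- Divergence-preserving branching bisimilarity

module _ {A : Set} (L : LTS A ℓ) where
  open LTS L

  record IsBranchingBisimulation (R : Rel State ℓ) : Set ℓ where
    field
      symmetric  : Symmetric R
      transfer   : ∀ {s t a s′} → R s t → s —[ a ]→ s′ →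
                   ∃[ t″ ] ∃[ t′ ] (t ⇒ t″) × (t″ —[[ a ]]→ t′) × R s t″ × R s′ t′
      acceptance : ∀ {s t} → R s t → s ↓ → ∃[ t′ ] (t ⇒ t′) × (t′ ↓)

  DivergencePreserving : Rel State ℓ → Set ℓ
  DivergencePreserving R =
    ∀ (s : ℕ → State) (t : State) →
    (∀ i → s i —τ→ s (suc i)) →
    (∀ i → R (s i) t) →
    ∃[ t′ ] (t ⇒⁺ t′) × (∃[ i ] R (s i) t′)

  DPBranchingBisimilarStates : State → State → Set (lsuc ℓ)
  DPBranchingBisimilarStates s t =
    Σ[ R ∈ Rel State ℓ ] IsBranchingBisimulation R × DivergencePreserving R × R s t

module _ {A : Set} (L₁ : LTS A ℓ₁) (L₂ : LTS A ℓ₂) where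
  private
    module L₁ = LTS L₁
    module L₂ = LTS L₂

  data UnionStep : L₁.State ⊎ L₂.State → Actτ A → L₁.State ⊎ L₂.State → Set (ℓ₁ ⊔ ℓ₂) where
    left  : ∀ {s a s′} → s L₁.—[ a ]→ s′ → UnionStep (inj₁ s) a (inj₁ s′)
    right : ∀ {s a s′} → s L₂.—[ a ]→ s′ → UnionStep (inj₂ s) a (inj₂ s′)

  data UnionAccepting : L₁.State ⊎ L₂.State → Set (ℓ₁ ⊔ ℓ₂) where
    left  : ∀ {s} → s L₁.↓ → UnionAccepting (inj₁ s)
    right : ∀ {s} → s L₂.↓ → UnionAccepting (inj₂ s)

  disjointUnion : LTS A (ℓ₁ ⊔ ℓ₂)
  disjointUnion = record
    { State   = L₁.State ⊎ L₂.State
    ; _—[_]→_ = UnionStep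
    ; _↓      = UnionAccepting
    }

DPBranchingBisimilar : {A : Set} → ProcessGraph A ℓ₁ → ProcessGraph A ℓ₂ → Set (lsuc (ℓ₁ ⊔ ℓ₂))
DPBranchingBisimilar G H =
  DPBranchingBisimilarStates (disjointUnion G.lts H.lts) (inj₁ G.root) (inj₂ H.root)
  where
  module G = ProcessGraph G
  module H = ProcessGraph H

-- A process graph over A seen as one over a larger action set B ⊇ A.
extendActions : {A B : Set} → A ↣ B → ProcessGraph A ℓ → ProcessGraph B ℓ
extendActions ι G = record
  { lts  = record
    { State   = State
    ; _—[_]→_ = λ s b s′ → ∃[ a ] (mapτ (Injection.to ι) a ≡ b) × (s —[ a ]→ s′)
    ; _↓      = _↓
    }
  ; root = root
  }
  where
  open ProcessGraph G
  open LTS lts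

------------------------------------------------------------------------
-- Bags

-- A bag over an n-element set, given by its multiplicities, so that
-- propositional equality is equality of bags.
Bag : ℕ → Set
Bag n = Vec ℕ n

module _ {n : ℕ} where

  infixr 6 _∪_
  infix  4 _∉ᵇ_

  ∅ : Bag n
  ∅ = replicate n 0

  ⦃|_|⦄ : Fin n → Bag n
  ⦃| d |⦄ = ∅ [ d ]≔ 1

  _∪_ : Bag n → Bag n → Bag n
  _∪_ = zipWith _+_

  _∉ᵇ_ : Fin n → Bag n → Set
  d ∉ᵇ x = lookup x d ≡ 0

------------------------------------------------------------------------
-- Parallel pushdown automata

data Signed (D : Set) : Set where
  +ₛ_ : D → Signed D
  -ₛ_ : D → Signed D

record ParallelPDA : Set where
  field
    #states #inputs #data : ℕ

  State : Set
  State = Fin #states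

  Input : Set
  Input = Fin #inputs

  Datum : Set
  Datum = Fin #data

  field
    transitions : List (State × Actτ Input × Signed Datum × Bag #data × State)
    initial     : State
    accepting   : Subset #states

module _ (M : ParallelPDA) where
  open ParallelPDA M

  data PDAStep : State × Bag #data → Actτ Input → State × Bag #data → Set where
    present : ∀ {s a d x′ s′ x} → (s , a , +ₛ d , x′ , s′) ∈ transitions →
              PDAStep (s , ⦃| d |⦄ ∪ x) a (s′ , x′ ∪ x)
    absent  : ∀ {s a d x′ s′ x} → (s , a , -ₛ d , x′ , s′) ∈ transitions → d ∉ᵇ x →
              PDAStep (s , x) a (s′ , x′ ∪ x)

  pdaGraph : ProcessGraph Input 0ℓ
  pdaGraph = record
    { lts  = record
      { State   = State × Bag #data
      ; _—[_]→_ = PDAStep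
      ; _↓      = λ (s , _) → s ∈ˢ accepting
      }
    ; root = initial , ∅
    }

------------------------------------------------------------------------
-- BCP⁰¹ with infinite choice

-- Countable means injecting into ℕ; this includes the finite sets.
Countable : Set → Set
Countable I = I ↣ ℕ

-- The parameters 𝒜, 𝒞 and 𝒱. The action set 𝒜 is given by its elements
-- other than the communication actions c!v, c?v and c(v).
record Signature : Set₁ where
  field
    Other           : Set
    #ports          : ℕ
    Value           : Set
    value-countable : Countable Value

  Port : Set
  Port = Fin #ports

  data Action : Set where
    other : Other → Action
    _!_   : Port → Value → Action
    _??_  : Port → Value → Action
    _⟨_⟩  : Port → Value → Action

other-injection : (Sig : Signature) → Signature.Other Sig ↣ Signature.Action Sig
other-injection Sig = record
  { to        = Signature.other
  ; cong      = cong Signature.other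
  ; injective = λ { refl → refl }
  }

module _ (Sig : Signature) where
  open Signature Sig

  infixr 8 _∙_
  infixr 6 _⊕_
  infixr 7 _∥_

  -- Process expressions over n process identifiers.
  data Proc (n : ℕ) : Set₁ where
    𝟎 𝟏   : Proc n
    _∙_   : Actτ Action → Proc n → Proc n
    _⊕_   : Proc n → Proc n → Proc n
    ∑     : (I : Set) → Countable I → (I → Proc n) → Proc n
    _∥_   : Proc n → Proc n → Proc n
    ident : Fin n → Proc n
    ∂     : Subset #ports → Proc n → Proc n
    hide  : Subset #ports → Proc n → Proc n   -- the operator τ_C

  data COM (C : Subset #ports) : Actτ Action → Set where
    send    : ∀ {c v} → c ∈ˢ C → COM C (act (c ! v))
    receive : ∀ {c v} → c ∈ˢ C → COM C (act (c ?? v))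

  data CommunicationAt (C : Subset #ports) : Actτ Action → Set where
    communication : ∀ {c v} → c ∈ˢ C → CommunicationAt C (act (c ⟨ v ⟩))

  record Specification : Set₁ where
    field
      #identifiers : ℕ
      definition   : Fin #identifiers → Proc #identifiers
      initial      : Fin #identifiers

module _ {Sig : Signature} where
  open Signature Sig

  -- No case for identifiers, and no condition below an action prefix.
  data Guarded {n : ℕ} : Proc Sig n → Set₁ where
    𝟎      : Guarded 𝟎
    𝟏      : Guarded 𝟏
    prefix : ∀ {a p} → Guarded (a ∙ p)
    _⊕_    : ∀ {p q} → Guarded p → Guarded q → Guarded (p ⊕ q)
    ∑      : ∀ {I cI p} → (∀ i → Guarded (p i)) → Guarded (∑ I cI p)
    _∥_    : ∀ {p q} → Guarded p → Guarded q → Guarded (p ∥ q)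
    ∂      : ∀ {C p} → Guarded p → Guarded (∂ C p)
    hide   : ∀ {C p} → Guarded p → Guarded (hide C p)

  WeaklyGuarded : Specification Sig → Set₁
  WeaklyGuarded Γ = ∀ X → Guarded (Specification.definition Γ X)

  module _ (Γ : Specification Sig) where
    open Specification Γ

    data Accepts : Proc Sig #identifiers → Set₁ where
      𝟏     : Accepts 𝟏
      ⊕ˡ    : ∀ {p q} → Accepts p → Accepts (p ⊕ q)
      ⊕ʳ    : ∀ {p q} → Accepts q → Accepts (p ⊕ q)
      ∑     : ∀ {I cI p} j → Accepts (p j) → Accepts (∑ I cI p)
      _∥_   : ∀ {p q} → Accepts p → Accepts q → Accepts (p ∥ q)
      ident : ∀ {X} → Accepts (definition X) → Accepts (ident X)
      ∂     : ∀ {C p} → Accepts p → Accepts (∂ C p)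
      hide  : ∀ {C p} → Accepts p → Accepts (hide C p)

    data Step : Proc Sig #identifiers → Actτ Action → Proc Sig #identifiers → Set₁ where
      prefix   : ∀ {a p} → Step (a ∙ p) a p
      ⊕ˡ       : ∀ {p q a p′} → Step p a p′ → Step (p ⊕ q) a p′
      ⊕ʳ       : ∀ {p q a q′} → Step q a q′ → Step (p ⊕ q) a q′
      ∑        : ∀ {I cI p a p′} j → Step (p j) a p′ → Step (∑ I cI p) a p′
      ∥ˡ       : ∀ {p q a p′} → Step p a p′ → Step (p ∥ q) a (p′ ∥ q)
      ∥ʳ       : ∀ {p q a q′} → Step q a q′ → Step (p ∥ q) a (p ∥ q′)
      ∥-!?     : ∀ {p q c v p′ q′} → Step p (act (c ! v)) p′ → Step q (act (c ?? v)) q′ →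
                 Step (p ∥ q) (act (c ⟨ v ⟩)) (p′ ∥ q′)
      ∥-?!     : ∀ {p q c v p′ q′} → Step p (act (c ?? v)) p′ → Step q (act (c ! v)) q′ →
                 Step (p ∥ q) (act (c ⟨ v ⟩)) (p′ ∥ q′)
      ident    : ∀ {X a p′} → Step (definition X) a p′ → Step (ident X) a p′
      ∂        : ∀ {C p a p′} → Step p a p′ → ¬ COM Sig C a → Step (∂ C p) a (∂ C p′)
      hide-in  : ∀ {C p c v p′} → Step p (act (c ⟨ v ⟩)) p′ → c ∈ˢ C →
                 Step (hide C p) τ (hide C p′)
      hide-out : ∀ {C p a p′} → Step p a p′ → ¬ CommunicationAt Sig C a →
                 Step (hide C p) a (hide C p′)

    specGraph : ProcessGraph Action (lsuc 0ℓ)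
    specGraph = record
      { lts  = record
        { State   = Proc Sig #identifiers
        ; _—[_]→_ = Step
        ; _↓      = Accepts
        }
      ; root = ident initial
      }

{-# OPTIONS --safe #-}

-- Every process graph with countably many states, countably many outgoing
-- transitions per state and countable acceptance is specified by two processes
-- that hand the current state to each other as a communicated value.  The first,
-- on receiving the state v, behaves as v: it performs some transition v —a→ w and
-- then sends w to the second, which sends it back.  Restricted and abstracted, the
-- exchange is a deterministic sequence of τ-steps of bounded length between two
-- transitions of the graph, so it is inert and introduces no divergence.

module Submission where

open import Defs
open import Level using (Level; _⊔_; 0ℓ)
open import Data.Empty using (⊥; ⊥-elim)
open import Data.Fin using (Fin; zero; suc; toℕ)
open import Data.Fin.Properties using (toℕ-injective; suc-injective)
import Data.Fin.Subset as Subset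
open import Data.List using (List; length)
open import Data.List.Membership.Propositional using (_∈_)
open import Data.List.Relation.Unary.Any using (here; there; index)
open import Data.Nat using (ℕ; zero; suc)
open import Data.Nat.Binary using (ℕᵇ; zero; 2[1+_]; 1+[2_]) renaming (toℕ to toℕᵇ)
import Data.Nat.Binary.Properties as ℕᵇ
open import Data.Nat.Properties using (≡-irrelevant)
open import Data.Product using (Σ-syntax; ∃-syntax; _×_; _,_; proj₁; proj₂)
import Data.Product.Properties.WithK as Product
open import Data.Sum using (inj₁; inj₂)
open import Data.Vec using (Vec; []; _∷_; here)
open import Data.Vec.Properties using (∷-injectiveˡ; ∷-injectiveʳ)
open import Data.Vec.Properties.WithK using ([]=-irrelevant)
open import Function.Bundles using (_↣_; mk↣)
open import Function.Construct.Composition using (_↣-∘_)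
open import Function.Construct.Identity using (↣-id)
open import Relation.Binary.Construct.Closure.ReflexiveTransitive using (ε; _◅_)
open import Relation.Binary.Construct.Closure.Transitive using ([_]; _∷_)
open import Relation.Binary.PropositionalEquality using (_≡_; refl; cong; cong₂; sym; subst)

-- Stuttering simulations

module _ {B : Set} {ℓ₁ ℓ₂ : Level} (L₁ : LTS B ℓ₁) (L₂ : LTS B ℓ₂) where
  private
    module L₁ = LTS L₁
    module L₂ = LTS L₂
    U = disjointUnion L₁ L₂
  open LTS U using (State; _—[_]→_; _—[[_]]→_; _—τ→_; _⇒_; _⇒⁺_; _↓)

  -- The index of Rep counts the inert τ-steps that remain before p can act as v.
  record IsStutteringBisimulation
           (Rep : ℕ → L₁.State → L₂.State → Set (ℓ₁ ⊔ ℓ₂)) : Set (ℓ₁ ⊔ ℓ₂) where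
    field
      inert       : ∀ {k p v} → Rep (suc k) p v → ∃[ q ] (p L₁.—[ τ ]→ q) × Rep k q v
      only-inert  : ∀ {k p v b q} → Rep (suc k) p v → p L₁.—[ b ]→ q → b ≡ τ × Rep k q v
      forth       : ∀ {p v b q} → Rep 0 p v → p L₁.—[ b ]→ q →
                    ∃[ k ] ∃[ w ] (v L₂.—[ b ]→ w) × Rep k q w
      back        : ∀ {p v b w} → Rep 0 p v → v L₂.—[ b ]→ w →
                    ∃[ k ] ∃[ q ] (p L₁.—[ b ]→ q) × Rep k q w
      accept-forth : ∀ {k p v} → Rep k p v → p L₁.↓ → v L₂.↓
      accept-back  : ∀ {p v} → Rep 0 p v → v L₂.↓ → p L₁.↓

  module _ {Rep : ℕ → L₁.State → L₂.State → Set (ℓ₁ ⊔ ℓ₂)}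
           (isStuttering : IsStutteringBisimulation Rep) where
    open IsStutteringBisimulation isStuttering

    data Related : State → State → Set (ℓ₁ ⊔ ℓ₂) where
      represents  : ∀ {k p v} → Rep k p v → Related (inj₁ p) (inj₂ v)
      represented : ∀ {k p v} → Rep k p v → Related (inj₂ v) (inj₁ p)

    settle : ∀ {k p v} → Rep k p v → ∃[ q ] (inj₁ p ⇒ inj₁ q) × Rep 0 q v
    settle {zero}  r = _ , ε , r
    settle {suc k} r with inert r
    ... | _ , st , r′ with settle r′
    ... | q , sts , r₀ = q , left st ◅ sts , r₀

    ⇒-∷ʳ : ∀ {s t u} → s ⇒ t → t —τ→ u → s ⇒⁺ u
    ⇒-∷ʳ ε          st′ = [ st′ ]
    ⇒-∷ʳ (st ◅ sts) st′ = st ∷ ⇒-∷ʳ sts st′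

    related-isBranchingBisimulation : IsBranchingBisimulation U Related
    related-isBranchingBisimulation = record
      { symmetric  = λ { (represents r) → represented r ; (represented r) → represents r }
      ; transfer   = transfer
      ; acceptance = acceptance
      }
      where
      transfer : ∀ {s t a s′} → Related s t → s —[ a ]→ s′ →
                 ∃[ t″ ] ∃[ t′ ] (t ⇒ t″) × (t″ —[[ a ]]→ t′) × Related s t″ × Related s′ t′
      transfer (represents {zero} r) (left st) with forth r st
      ... | _ , w , st′ , r′ =
        _ , inj₂ w , ε , inj₁ (right st′) , represents r , represents r′
      -- The graph state stays put: it is represented both before and after an inert step.
      transfer (represents {suc k} r) (left st) with only-inert r st
      ... | refl , r′ = _ , _ , ε , inj₂ (refl , refl) , represents r , represents r′
      -- The process first runs off its inert steps, all the while representing the same state, and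
      -- can then act as that state.
      transfer (represented r) (right st) with settle r
      ... | q , sts , r₀ with back r₀ st
      ... | _ , q′ , st′ , r′ =
        inj₁ q , inj₁ q′ , sts , inj₁ (left st′) , represented r₀ , represented r′

      acceptance : ∀ {s t} → Related s t → s ↓ → ∃[ t′ ] (t ⇒ t′) × (t′ ↓)
      acceptance (represents r)  (left acc)  = _ , ε , right (accept-forth r acc)
      acceptance (represented r) (right acc) with settle r
      ... | q , sts , r₀ = inj₁ q , sts , left (accept-back r₀ acc)

    -- If the sequence runs through processes, `leave` finds a step that the graph state can
    -- imitate. If it runs through graph states, the settled process imitates its first step.
    related-divergencePreserving : DivergencePreserving U Related
    related-divergencePreserving s t steps rel = go (rel 0) refl
      where
      Goal : State → Set (ℓ₁ ⊔ ℓ₂)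
      Goal u = ∃[ t′ ] (u ⇒⁺ t′) × (∃[ i ] Related (s i) t′)

      -- Exposes the injection in the source, so that matching on the step leaves a single side of
      -- the union.
      step-from : ∀ {u} i → s i ≡ u → u —τ→ s (suc i)
      step-from i eq = subst (_—τ→ s (suc i)) eq (steps i)

      -- Only `k` inert steps can be taken in a row; the step after them is one that `forth` turns
      -- into a τ-transition of `v`.
      leave : ∀ k i {p v} → s i ≡ inj₁ p → Rep k p v → Goal (inj₂ v)
      leave k i eq r with s (suc i) in eq′ | step-from i eq
      leave zero i eq r | _ | left st with forth r st
      ... | _ , w , st′ , r′ =
        inj₂ w , [ right st′ ] , suc i ,
        subst (λ z → Related z (inj₂ w)) (sym eq′) (represents r′)
      leave (suc k) i eq r | _ | left st with only-inert r st
      ... | _ , r′ = leave k (suc i) eq′ r′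

      go : ∀ {s₀ u} → Related s₀ u → s 0 ≡ s₀ → Goal u
      go (represents {k} r) eq = leave k 0 eq r
      go (represented r) eq with s 1 in eq′ | step-from 0 eq
      ... | _ | right st with settle r
      ... | q , sts , r₀ with back r₀ st
      ... | _ , q′ , st′ , r′ =
        inj₁ q′ , ⇒-∷ʳ sts (left st′) , 1 ,
        subst (λ z → Related z (inj₁ q′)) (sym eq′) (represented r′)

    stuttering⇒bisimilar : ∀ {k p v} → Rep k p v →
                           DPBranchingBisimilarStates U (inj₁ p) (inj₂ v)
    stuttering⇒bisimilar r =
      Related , related-isBranchingBisimulation , related-divergencePreserving , represents r

-- Specifying a countable process graph

module _ {A : Set} (G : ProcessGraph A 0ℓ) where
  open ProcessGraph G renaming (root to root-state)
  open LTS lts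

  Outgoing : State → Set
  Outgoing v = ∃[ a ] ∃[ w ] (v —[ a ]→ w)

  module Exchange (state-countable      : Countable State)
                  (outgoing-countable   : ∀ v → Countable (Outgoing v))
                  (acceptance-countable : ∀ v → Countable (v ↓)) where

    Sig : Signature
    Sig = record
      { Other           = A
      ; #ports          = 1
      ; Value           = State
      ; value-countable = state-countable
      }

    open Signature Sig using (Port; Action; other; _!_; _??_)

    port : Port
    port = zero

    pattern initialId = zero
    pattern actorId   = suc zero
    pattern relayId   = suc (suc zero)

    Process : Set₁
    Process = Proc Sig 3

    actor relay : Process
    actor = ident actorId
    relay = ident relayId

    offer : State → Process → Process
    offer v p = act (port ! v) ∙ p

    -- An empty sum does not accept, so summing `𝟏` over the proofs of `v ↓` yields acceptance
    -- exactly when `v` accepts.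
    perform : State → Process
    perform v = ∑ (Outgoing v) (outgoing-countable v) (λ (a , w , _) → mapτ other a ∙ offer w actor)
              ⊕ ∑ (v ↓) (acceptance-countable v) (λ _ → 𝟏)

    -- `∂` blocks lone sends and receives, so only their synchronisation remains, which `hide` turns
    -- into τ.
    scope : Process → Process
    scope p = hide Subset.⊤ (∂ Subset.⊤ p)

    Γ : Specification Sig
    Γ = record
      { #identifiers = 3
      ; initial      = initialId
      ; definition   = λ
        -- The leading τ guards `actor`, at the price of one more inert step.
        { initialId → τ ∙ scope (actor ∥ offer root-state relay)
        ; actorId   → ∑ State state-countable (λ v → act (port ?? v) ∙ perform v)
        -- The summand `𝟏` lets the idle relay accept, so it does not block acceptance by
        -- `perform v`.
        ; relayId   → ∑ State state-countable (λ v → act (port ?? v) ∙ offer v relay) ⊕ 𝟏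
        }
      }

    Γ-weaklyGuarded : WeaklyGuarded Γ
    Γ-weaklyGuarded initialId = prefix
    Γ-weaklyGuarded actorId   = ∑ λ _ → prefix
    Γ-weaklyGuarded relayId   = ∑ (λ _ → prefix) ⊕ 𝟏

    -- All that remains in `returning` is the communication from relay to actor. Before it,
    -- `handing` has the communication to the relay and `starting` has the guarding τ.
    data Represents : ℕ → Process → State → Set₁ where
      performing : ∀ {v} → Represents 0 (scope (perform v ∥ relay)) v
      returning  : ∀ {v} → Represents 1 (scope (actor ∥ offer v relay)) v
      handing    : ∀ {v} → Represents 2 (scope (offer v actor ∥ relay)) v
      starting   : Represents 2 (ident initialId) root-state

    perform-step : ∀ {v b p} → Step Γ (perform v) b p →
                   ∃[ a ] ∃[ w ] (v —[ a ]→ w) × b ≡ mapτ other a × p ≡ offer w actor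
    perform-step (⊕ˡ (∑ (a , w , st) prefix)) = a , w , st , refl , refl
    perform-step (⊕ʳ (∑ _ ()))

    -- Serves to exclude that `perform v` synchronises with `relay` or that its own actions get
    -- hidden.
    perform-external : ∀ {v b p} → Step Γ (perform v) (act b) p → ∃[ a ] b ≡ other a
    perform-external st with perform-step st
    ... | act a , _ , _ , refl , _ = a , refl

    external-allowed : ∀ {C} a → COM Sig C (mapτ other a) → ⊥
    external-allowed τ       ()
    external-allowed (act a) ()

    external-not-hidden : ∀ {C} a → CommunicationAt Sig C (mapτ other a) → ⊥
    external-not-hidden τ       ()
    external-not-hidden (act a) ()

    ι : A ↣ A
    ι = ↣-id A

    H : ProcessGraph Action 0ℓ
    H = extendActions (other-injection Sig ↣-∘ ι) G

    module H = LTS (ProcessGraph.lts H)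

    -- Transitions and acceptance at each stage of the exchange

    inert : ∀ {k p v} → Represents (suc k) p v → ∃[ q ] Step Γ p τ q × Represents k q v
    inert returning = _ , hide-in (∂ (∥-?! (ident (∑ _ prefix)) prefix) λ ()) here , performing
    inert handing   =
      _ , hide-in (∂ (∥-!? prefix (ident (⊕ˡ (∑ _ prefix)))) λ ()) here , returning
    inert starting  = _ , ident prefix , returning

    -- In `returning` and `handing` one side can only send and the other only receive. Either action
    -- alone is blocked, and the received value must be the one sent.
    only-inert : ∀ {k p v b q} → Represents (suc k) p v → Step Γ p b q → b ≡ τ × Represents k q v
    only-inert starting (ident prefix) = refl , returning
    only-inert returning (hide-in (∂ (∥ˡ (ident (∑ _ ()))) _) _)
    only-inert returning (hide-in (∂ (∥ʳ ()) _) _)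
    only-inert returning (hide-in (∂ (∥-!? (ident (∑ _ ())) _) _) _)
    only-inert returning (hide-in (∂ (∥-?! (ident (∑ _ prefix)) prefix) _) _) = refl , performing
    only-inert returning (hide-out (∂ (∥ˡ (ident (∑ _ prefix))) ¬com) _) =
      ⊥-elim (¬com (receive here))
    only-inert returning (hide-out (∂ (∥ʳ prefix) ¬com) _) = ⊥-elim (¬com (send here))
    only-inert returning (hide-out (∂ (∥-!? (ident (∑ _ ())) _) _) _)
    only-inert returning (hide-out (∂ (∥-?! (ident (∑ _ prefix)) prefix) _) ¬comm) =
      ⊥-elim (¬comm (communication here))
    only-inert handing (hide-in (∂ (∥ˡ ()) _) _)
    only-inert handing (hide-in (∂ (∥ʳ (ident (⊕ˡ (∑ _ ())))) _) _)
    only-inert handing (hide-in (∂ (∥ʳ (ident (⊕ʳ ()))) _) _)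
    only-inert handing (hide-in (∂ (∥-!? prefix (ident (⊕ˡ (∑ _ prefix)))) _) _) = refl , returning
    only-inert handing (hide-out (∂ (∥ˡ prefix) ¬com) _) = ⊥-elim (¬com (send here))
    only-inert handing (hide-out (∂ (∥ʳ (ident (⊕ˡ (∑ _ prefix)))) ¬com) _) =
      ⊥-elim (¬com (receive here))
    only-inert handing (hide-out (∂ (∥-!? prefix (ident (⊕ˡ (∑ _ prefix)))) _) ¬comm) =
      ⊥-elim (¬comm (communication here))

    forth : ∀ {p v b q} → Represents 0 p v → Step Γ p b q →
            ∃[ k ] ∃[ w ] (v H.—[ b ]→ w) × Represents k q w
    forth performing (hide-in (∂ (∥ˡ st) _) _) with perform-external st
    ... | _ , ()
    forth performing (hide-in (∂ (∥ʳ (ident (⊕ˡ (∑ _ ())))) _) _)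
    forth performing (hide-in (∂ (∥ʳ (ident (⊕ʳ ()))) _) _)
    forth performing (hide-in (∂ (∥-!? st _) _) _) with perform-external st
    ... | _ , ()
    forth performing (hide-in (∂ (∥-?! st _) _) _) with perform-external st
    ... | _ , ()
    forth performing (hide-out (∂ (∥ˡ st) _) _) with perform-step st
    ... | a , w , st′ , refl , refl = 2 , w , (a , refl , st′) , handing
    forth performing (hide-out (∂ (∥ʳ (ident (⊕ˡ (∑ _ prefix)))) ¬com) _) =
      ⊥-elim (¬com (receive here))
    forth performing (hide-out (∂ (∥-!? st _) _) _) with perform-external st
    ... | _ , ()
    forth performing (hide-out (∂ (∥-?! st _) _) _) with perform-external st
    ... | _ , ()

    back : ∀ {p v b w} → Represents 0 p v → v H.—[ b ]→ w →
           ∃[ k ] ∃[ q ] Step Γ p b q × Represents k q w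
    back performing (a , refl , st) =
      2 , _ ,
      hide-out (∂ (∥ˡ (⊕ˡ (∑ (a , _ , st) prefix))) (external-allowed a)) (external-not-hidden a) ,
      handing

    -- Outside `performing` there is a pending action prefix, which does not accept.
    accept-forth : ∀ {k p v} → Represents k p v → Accepts Γ p → v ↓
    accept-forth performing (hide (∂ (⊕ʳ (∑ acc _) ∥ _))) = acc
    accept-forth performing (hide (∂ (⊕ˡ (∑ _ ()) ∥ _)))
    accept-forth returning  (hide (∂ (_ ∥ ())))
    accept-forth handing    (hide (∂ (() ∥ _)))
    accept-forth starting   (ident ())

    accept-back : ∀ {p v} → Represents 0 p v → v ↓ → Accepts Γ p
    accept-back performing acc = hide (∂ (⊕ʳ (∑ acc 𝟏) ∥ ident (⊕ʳ 𝟏)))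

    represents-isStuttering :
      IsStutteringBisimulation (ProcessGraph.lts (specGraph Γ)) (ProcessGraph.lts H) Represents
    represents-isStuttering = record
      { inert        = inert
      ; only-inert   = only-inert
      ; forth        = forth
      ; back         = back
      ; accept-forth = accept-forth
      ; accept-back  = accept-back
      }

    Γ-bisimilar : DPBranchingBisimilar (specGraph Γ) H
    Γ-bisimilar = stuttering⇒bisimilar _ _ represents-isStuttering starting

-- Countability of the graph of a parallel pushdown automaton

-- A number m is written as m digits 1 and one digit 2, in bijective base 2.
encode : ∀ {n} → Vec ℕ n → ℕᵇ
encode []           = zero
encode (zero  ∷ ms) = 2[1+ encode ms ]
encode (suc m ∷ ms) = 1+[2 encode (m ∷ ms) ]

encode-injective : ∀ {n} {ms ns : Vec ℕ n} → encode ms ≡ encode ns → ms ≡ ns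
encode-injective {ms = []}         {[]}         _  = refl
encode-injective {ms = zero  ∷ ms} {zero  ∷ ns} eq =
  cong (zero ∷_) (encode-injective (ℕᵇ.2[1+_]-injective eq))
encode-injective {ms = suc m ∷ ms} {suc n ∷ ns} eq
  with encode-injective (ℕᵇ.1+[2_]-injective eq)
... | refl = refl

-- Serves both for configurations and for steps, the latter coded by a rule and a residual bag.
Fin×Vec-countable : ∀ {m n} → Countable (Fin m × Vec ℕ n)
Fin×Vec-countable = mk↣ {to = code} λ eq → code-injective (encode-injective (ℕᵇ.toℕ-injective eq))
  where
  code : ∀ {m n} → Fin m × Vec ℕ n → ℕ
  code (i , ms) = toℕᵇ (encode (toℕ i ∷ ms))

  code-injective : ∀ {m n} {p q : Fin m × Vec ℕ n} →
                   toℕ (proj₁ p) ∷ proj₂ p ≡ toℕ (proj₁ q) ∷ proj₂ q → p ≡ q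
  code-injective eq = cong₂ _,_ (toℕ-injective (∷-injectiveˡ eq)) (∷-injectiveʳ eq)

-- A position determines the element found there. Pairing each proof with its element makes the two
-- comparable.
∈-index-injective : ∀ {A : Set} {xs : List A} {x y} (p : x ∈ xs) (q : y ∈ xs) →
                    index p ≡ index q → _≡_ {A = ∃[ z ] z ∈ xs} (x , p) (y , q)
∈-index-injective (here refl) (here refl) _  = refl
∈-index-injective (there p)   (there q)   eq with ∈-index-injective p q (suc-injective eq)
... | refl = refl

module _ (M : ParallelPDA) where
  open ParallelPDA M renaming (State to Control)

  rule : ∀ {c a d} → PDAStep M c a d → Fin (length transitions)
  rule (present t)  = index t
  rule (absent t _) = index t

  -- The part of the bag that the step carries over; together with the rule it fixes source and
  -- target.
  residue : ∀ {c a d} → PDAStep M c a d → Bag #data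
  residue (present {x = x} _)  = x
  residue (absent {x = x} _ _) = x

  -- The sources c and c′ are kept apart so that the two steps can be matched
  -- without unifying ⦃| d |⦄ ∪ x with another such bag.
  step-determined : ∀ {c c′ a a′ d d′} (st : PDAStep M c a d) (st′ : PDAStep M c′ a′ d′) →
                    rule st ≡ rule st′ → residue st ≡ residue st′ →
                    _≡_ {A = Σ[ c ∈ Control × Bag #data ] Outgoing (pdaGraph M) c}
                        (c , a , d , st) (c′ , a′ , d′ , st′)
  step-determined (present t) (present t′) i refl with ∈-index-injective t t′ i
  ... | refl = refl
  -- The transition at one position carries one sign, so the two steps cannot share a rule.
  step-determined (present t) (absent t′ _) i _ with ∈-index-injective t t′ i
  ... | ()
  step-determined (absent t _) (present t′) i _ with ∈-index-injective t t′ i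
  ... | ()
  step-determined (absent t d∉x) (absent t′ d∉x′) i refl with ∈-index-injective t t′ i
  ... | refl with ≡-irrelevant d∉x d∉x′
  ...   | refl = refl

  outgoing-countable : ∀ c → Countable (Outgoing (pdaGraph M) c)
  outgoing-countable c = Fin×Vec-countable ↣-∘
    mk↣ {to = λ (_ , _ , st) → rule st , residue st}
        λ {(_ , _ , st)} {(_ , _ , st′)} eq →
          -- Both steps leave `c`, so by axiom K the equality of the pairs restricts to their second
          -- components.
          Product.,-injectiveʳ (step-determined st st′ (cong proj₁ eq) (cong proj₂ eq))

  -- Membership in a subset has at most one proof, so even a constant map is injective.
  acceptance-countable : ∀ s → Countable (s Subset.∈ accepting)
  acceptance-countable s = mk↣ {to = λ _ → 0} λ _ → []=-irrelevant _ _

theorem14 : (M : ParallelPDA) →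
    Σ[ Sig ∈ Signature ]
    Σ[ ι ∈ ParallelPDA.Input M ↣ Signature.Other Sig ]
    Σ[ Γ ∈ Specification Sig ]
    WeaklyGuarded Γ ×
    DPBranchingBisimilar (specGraph Γ) (extendActions (other-injection Sig ↣-∘ ι) (pdaGraph M))
theorem14 M = Sig , ι , Γ , Γ-weaklyGuarded , Γ-bisimilar
  where
  open Exchange (pdaGraph M) Fin×Vec-countable (outgoing-countable M)
                (λ (s , _) → acceptance-countable M s)
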